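{- Let $T$ be a tree of order $n\ge 2$. Then $\gamma_{\rm esp}(T)=\frac{1}{2}n$ if and only if there exists a $2$-coloring of $T$ such that $T\in\mathcal{T}$.
   Context: Graphs are finite, simple and undirected. For a graph $G=(V,E)$ and $S\subseteq V$, write $\overline{S}=V\setminus S$, and let $N(v)$ be the open neighbourhood of $v$. A set $S \subseteq V$ is an end super dominating set (ESD-set) of $G$ if for every $u\in\overline{S}$ there exists $v\in S$ with $N(v)\cap\overline{S}=\{u\}$, and moreover $\deg(u)\ge 2$ for every $u\in\overline{S}$. The end super domination number $\gamma_{\rm esp}(G)$ is the minimum cardinality of an ESD-set of $G$. A $2$-coloring of a tree $T$ is an assignment of one of the two colors amber and blue to each vertex of $T$ (no properness is required). The family $\mathcal{T}$ is the family of $2$-colored trees that can be obtained as the last term $T_k$ of a sequence $T_1,\ldots,T_k$, $k\ge 1$, of $2$-colored trees, where $T_1$ is the path $P_4$ with its two leaves colored blue and its two vertices of degree $2$ colored amber, and, if $k\ge 2$, for each $i\in\{1,\ldots,k-1\}$ the $2$-colored tree $T_{i+1}$ is obtained from $T_i$ by one of the following two operations. Operation $\mathcal{O}_1$: add a (vertex-disjoint) path $P_2$ to $T_i$, with one vertex of the added path colored amber and the other blue, and add an edge from the amber vertex of the added path to an amber vertex of $T_i$. Operation $\mathcal{O}_2$: add a (vertex-disjoint) path $P_4$ to $T_i$, with its two leaves colored blue and its two vertices of degree $2$ colored amber, and add an edge from a (blue) leaf of the added path to a blue vertex of $T_i$. -}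

module Defs where

open import Data.Bool.Properties using () renaming (_≟_ to _≟ᵇ_)
open import Data.Fin using (Fin; zero; suc; toℕ; inject₁; fromℕ; splitAt)
open import Data.Fin.Properties using (all?; any?) renaming (_≟_ to _≟ᶠ_)
open import Data.Fin.Subset using (Subset; _∈_; ∁; _∩_; ⁅_⁆; ∣_∣; ⊤)
open import Data.Fin.Subset.Properties using (_∈?_; anySubset?; x∈∁p⇒x∉p; ∈⊤)
open import Data.Nat using (ℕ; zero; suc; _+_; _≤_; z≤n; s≤s; _≤?_) renaming (_≟_ to _≟ⁿ_)
open import Data.Nat.Properties using (1+n≢n)
open import Data.Product using (_×_; _,_; proj₁; ∃; ∃-syntax; swap)
open import Data.Sum using (_⊎_; inj₁; inj₂; [_,_]′) renaming (swap to swap⊎)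
open import Data.Vec using ([]; _∷_; lookup; tabulate)
open import Data.Vec.Properties using (≡-dec)
open import Function using (_∘_; _on_)
open import Function.Bundles using (_↔_; _⇔_; module Inverse)
open import Function.Definitions using (Injective)
open import Relation.Binary.Construct.Closure.ReflexiveTransitive using (Star)
open import Relation.Binary.PropositionalEquality using (_≡_; refl)
open import Relation.Nullary using (¬_; Dec; yes; no; does; contradiction)
open import Relation.Nullary.Decidable using (_×-dec_; _⊎-dec_; _→-dec_)

------------------------------------------------------------------------
-- Finite simple graphs on the vertex set Fin n

record Graph (n : ℕ) : Set₁ where
  field
    Adj        : Fin n → Fin n → Set
    Adj?       : ∀ u v → Dec (Adj u v)
    Adj-sym    : ∀ {u v} → Adj u v → Adj v u
    Adj-irrefl : ∀ {u} → ¬ Adj u u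

open Graph public

module _ {n : ℕ} (G : Graph n) where

  N : Fin n → Subset n
  N v = tabulate λ u → does (Adj? G v u)

  deg : Fin n → ℕ
  deg v = ∣ N v ∣

  Connected : Set
  Connected = ∀ u v → Star (Adj G) u v

  -- A cycle of length 3 + k: distinct vertices c 0, …, c (2 + k), consecutive
  -- ones adjacent, and the last one adjacent to the first.
  record Cycle : Set where
    field
      {k}       : ℕ
      c         : Fin (3 + k) → Fin n
      injective : Injective _≡_ _≡_ c
      steps     : ∀ (i : Fin (2 + k)) → Adj G (c (inject₁ i)) (c (suc i))
      closes    : Adj G (c (fromℕ (2 + k))) (c zero)

  -- Connected and acyclic. The graph on no vertices satisfies this vacuously,
  -- so a lower bound on n has to be assumed separately.
  IsTree : Set
  IsTree = Connected × ¬ Cycle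

------------------------------------------------------------------------
-- End super domination

  IsESD : Subset n → Set
  IsESD S = ∀ u → u ∈ ∁ S →
    (∃[ v ] v ∈ S × N v ∩ ∁ S ≡ ⁅ u ⁆) × 2 ≤ deg u

  IsESD? : ∀ S → Dec (IsESD S)
  IsESD? S = all? λ u → (u ∈? ∁ S) →-dec
    (any? (λ v → (v ∈? S) ×-dec ≡-dec _≟ᵇ_ (N v ∩ ∁ S) ⁅ u ⁆) ×-dec (2 ≤? deg u))

  ESD-⊤ : IsESD ⊤
  ESD-⊤ u u∈∁⊤ = contradiction ∈⊤ (x∈∁p⇒x∉p u∈∁⊤)

IsMinimum : (ℕ → Set) → ℕ → Set
IsMinimum P k = P k × (∀ j → P j → k ≤ j)

minimum : ∀ {P : ℕ → Set} → (∀ k → Dec (P k)) → ∀ m → P m → ∃ (IsMinimum P)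
minimum P? m pm with P? zero
... | yes p0 = zero , p0 , λ _ _ → z≤n
minimum P? zero    pm | no ¬p0 = contradiction pm ¬p0
minimum P? (suc m) pm | no ¬p0 with minimum (P? ∘ suc) m pm
... | k , pk , least = suc k , pk , λ
  { zero    p0 → contradiction p0 ¬p0
  ; (suc j) pj → s≤s (least j pj)
  }

module _ {n : ℕ} (G : Graph n) where

  ESDCardinality : ℕ → Set
  ESDCardinality k = ∃[ S ] IsESD G S × ∣ S ∣ ≡ k

  γesp-minimum : ∃ (IsMinimum ESDCardinality)
  γesp-minimum = minimum
    (λ k → anySubset? λ S → IsESD? G S ×-dec (∣ S ∣ ≟ⁿ k))
    ∣ ⊤ {n} ∣ (⊤ , ESD-⊤ G , refl)

  γesp : ℕ
  γesp = proj₁ γesp-minimum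

------------------------------------------------------------------------
-- Two-coloured graphs and the family 𝒯

data Colour : Set where
  amber blue : Colour

record ColouredGraph : Set₁ where
  constructor coloured
  field
    {order} : ℕ
    graph   : Graph order
    colour  : Fin order → Colour

open ColouredGraph public

record _≅_ (T U : ColouredGraph) : Set where
  field
    vertices : Fin (order T) ↔ Fin (order U)
  open Inverse vertices using (to)
  field
    adjacent : ∀ u v → Adj (graph T) u v ⇔ Adj (graph U) (to u) (to v)
    colours  : ∀ u → colour U (to u) ≡ colour T u

path : ∀ n → Graph n
path n = record
  { Adj        = λ u v → suc (toℕ u) ≡ toℕ v ⊎ suc (toℕ v) ≡ toℕ u
  ; Adj?       = λ u v → (suc (toℕ u) ≟ⁿ toℕ v) ⊎-dec (suc (toℕ v) ≟ⁿ toℕ u)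
  ; Adj-sym    = swap⊎
  ; Adj-irrefl = [ 1+n≢n , 1+n≢n ]′
  }

P₂ : ColouredGraph
P₂ = coloured (path 2) (lookup (amber ∷ blue ∷ []))

P₄ : ColouredGraph
P₄ = coloured (path 4) (lookup (blue ∷ amber ∷ amber ∷ blue ∷ []))

-- The disjoint union of G and H together with the edge joining x to y; the
-- vertices of G come first.
module _ {m p : ℕ} (G : Graph m) (H : Graph p) (x : Fin m) (y : Fin p) where

  JoinAdj : Fin m ⊎ Fin p → Fin m ⊎ Fin p → Set
  JoinAdj (inj₁ u) (inj₁ v) = Adj G u v
  JoinAdj (inj₁ u) (inj₂ v) = u ≡ x × v ≡ y
  JoinAdj (inj₂ u) (inj₁ v) = u ≡ y × v ≡ x
  JoinAdj (inj₂ u) (inj₂ v) = Adj H u v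

  JoinAdj? : ∀ a b → Dec (JoinAdj a b)
  JoinAdj? (inj₁ u) (inj₁ v) = Adj? G u v
  JoinAdj? (inj₁ u) (inj₂ v) = (u ≟ᶠ x) ×-dec (v ≟ᶠ y)
  JoinAdj? (inj₂ u) (inj₁ v) = (u ≟ᶠ y) ×-dec (v ≟ᶠ x)
  JoinAdj? (inj₂ u) (inj₂ v) = Adj? H u v

  JoinAdj-sym : ∀ a b → JoinAdj a b → JoinAdj b a
  JoinAdj-sym (inj₁ u) (inj₁ v) = Adj-sym G
  JoinAdj-sym (inj₁ u) (inj₂ v) = swap
  JoinAdj-sym (inj₂ u) (inj₁ v) = swap
  JoinAdj-sym (inj₂ u) (inj₂ v) = Adj-sym H

  JoinAdj-irrefl : ∀ a → ¬ JoinAdj a a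
  JoinAdj-irrefl (inj₁ u) = Adj-irrefl G
  JoinAdj-irrefl (inj₂ u) = Adj-irrefl H

  join : Graph (m + p)
  join = record
    { Adj        = JoinAdj on splitAt m
    ; Adj?       = λ u v → JoinAdj? (splitAt m u) (splitAt m v)
    ; Adj-sym    = λ {u} {v} → JoinAdj-sym (splitAt m u) (splitAt m v)
    ; Adj-irrefl = λ {u} → JoinAdj-irrefl (splitAt m u)
    }

attach : (T P : ColouredGraph) → Fin (order T) → Fin (order P) → ColouredGraph
attach T P x y = coloured
  (join (graph T) (graph P) x y)
  ([ colour T , colour P ]′ ∘ splitAt (order T))

-- In 𝒪₂ the condition on y says that y is a leaf, since the blue vertices of
-- P₄ are exactly its leaves.
data _⟶_ (T : ColouredGraph) : ColouredGraph → Set where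
  𝒪₁ : ∀ x y → colour T x ≡ amber → colour P₂ y ≡ amber → T ⟶ attach T P₂ x y
  𝒪₂ : ∀ x y → colour T x ≡ blue  → colour P₄ y ≡ blue  → T ⟶ attach T P₄ x y

-- Both operations act on concrete vertex sets, so membership is up to
-- colour-preserving isomorphism. Star allows zero operations.
𝒯 : ColouredGraph → Set₁
𝒯 T = ∃[ U ] Star _⟶_ P₄ U × U ≅ T

{-# OPTIONS --safe #-}
module Submission where

-- Choosing for each u ∉ S a vertex v ∈ S with N(v) ∖ S = {u} is an injection into S, so
-- |S| ≥ n/2, with equality iff S is the blue class of a colouring in which every vertex has
-- exactly one neighbour of the other colour (its mate) and every amber vertex has an amber
-- neighbour (which gives degree ≥ 2). Both operations preserve these properties. Conversely,
-- given such a colouring of a tree, grow a member of 𝒯 inside it, starting from mate – amber –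
-- amber – mate. An edge xy leaving the current subtree joins vertices of equal colour. If amber,
-- 𝒪₁ adds y and its mate. If blue, the mate of y has an amber neighbour z, and 𝒪₂ adds y, its
-- mate, z, and the mate of z. Since the tree is acyclic, z lies outside the current subtree, and
-- no edges other than those of the grown graph occur between its vertices.

open import Defs
open import Data.Bool using (if_then_else_)
open import Data.Bool.Properties using () renaming (_≟_ to _≟ᵇ_)
open import Data.Fin using (Fin; zero; suc; toℕ; fromℕ; fromℕ<; inject₁; inject≤; splitAt)
open import Data.Fin.Properties
  using (all?; any?; suc-injective; toℕ-injective; toℕ-inject₁; +↔⊎; injective⇒≤; ¬∀⟶∃¬)
  renaming (_≟_ to _≟ᶠ_)
open import Data.Fin.Subset using (Subset; _∈_; _∉_; ∁; _∩_; _-_; ⁅_⁆; ∣_∣; inside; outside)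
open import Data.Fin.Subset.Properties
  using ( _∈?_; x∈p⇒∣p-x∣<∣p∣; x∈p∧x≢y⇒x∈p-y; x∈⁅x⁆; x∈⁅y⁆⇒x≡y; ∣⁅x⁆∣≡1; p⊆q⇒∣p∣≤∣q∣
        ; x∈p∩q⁺; x∈p∩q⁻; x∈∁p⇒x∉p; x∉p⇒x∈∁p; ⊆-antisym; ∣∁p∣≡n∸∣p∣; ∣p∣≤n)
open import Data.Nat using (ℕ; zero; suc; _+_; _∸_; _*_; _≤_; _<_; _≥_; z≤n; s≤s)
open import Data.Nat.Properties hiding (suc-injective)
import Data.Nat.Properties as ℕ
open import Data.Product using (_×_; _,_; proj₁; proj₂; ∃-syntax)
open import Data.Sum using (_⊎_; inj₁; inj₂; [_,_]′)
open import Data.Vec using ([]; _∷_; here; there; lookup; tabulate)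
open import Data.Vec.Properties using (≡-dec; lookup∘tabulate; lookup⇒[]=; []=⇒lookup)
open import Data.Vec.Relation.Unary.All using ([]; _∷_)
open import Data.Vec.Relation.Unary.AllPairs using ([]; _∷_)
open import Data.Vec.Relation.Unary.Unique.Propositional.Properties using (lookup-injective)
open import Function using (_∘_; id)
open import Function.Bundles using (_↔_; _⇔_; mk⇔; mk↔ₛ′; module Inverse; module Equivalence)
open import Function.Definitions using (Injective)
open import Function.Properties.Inverse using (↔-sym)
open import Relation.Binary.Construct.Closure.ReflexiveTransitive
  using (Star; ε; _◅_; _◅◅_; gmap; reverse; return)
open import Relation.Binary.PropositionalEquality
open import Relation.Nullary using (¬_; Dec; does; yes; no; contradiction)
open import Relation.Nullary.Decidable using (True; toWitness; dec-true; _×-dec_; _→-dec_)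

private variable
  V W : Set
  m n : ℕ

-- Colours

flip : Colour → Colour
flip amber = blue
flip blue  = amber

flip-involutive : ∀ a → flip (flip a) ≡ a
flip-involutive amber = refl
flip-involutive blue  = refl

a≢flip[a] : ∀ a → a ≢ flip a
a≢flip[a] amber ()
a≢flip[a] blue  ()

a≡b⊎a≡flip[b] : ∀ a b → a ≡ b ⊎ a ≡ flip b
a≡b⊎a≡flip[b] amber amber = inj₁ refl
a≡b⊎a≡flip[b] amber blue  = inj₂ refl
a≡b⊎a≡flip[b] blue  amber = inj₂ refl
a≡b⊎a≡flip[b] blue  blue  = inj₁ refl

_≟ᶜ_ : (a b : Colour) → Dec (a ≡ b)
amber ≟ᶜ amber = yes refl
amber ≟ᶜ blue  = no λ ()
blue  ≟ᶜ amber = no λ ()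
blue  ≟ᶜ blue  = yes refl

-- Trails and bridges

-- `length` counts edges and no vertex repeats. The fields mirror those of `Cycle`, so that one
-- closing edge turns a trail with at least two edges into a cycle.
record Trail (E : V → V → Set) (u v : V) : Set where
  field
    {length}  : ℕ
    c         : Fin (suc length) → V
    injective : Injective _≡_ _≡_ c
    start     : c zero ≡ u
    end       : c (fromℕ length) ≡ v
    steps     : ∀ i → E (c (inject₁ i)) (c (suc i))

dropTrail : ∀ {E : V → V → Set} {k v} (c : Fin (suc k) → V) → Injective _≡_ _≡_ c →
  c (fromℕ k) ≡ v → (∀ i → E (c (inject₁ i)) (c (suc i))) → ∀ i → Trail E (c i) v
dropTrail c inj end steps zero = record
  { c = c ; injective = inj ; start = refl ; end = end ; steps = steps }
dropTrail {k = suc k} c inj end steps (suc i) =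
  dropTrail (c ∘ suc) (λ eq → suc-injective (inj eq)) end (steps ∘ suc) i

walk⇒trail : ∀ {E : Fin n → Fin n → Set} {u v} → Star E u v → Trail E u v
walk⇒trail {u = u} ε = record
  { length = 0
  ; c = λ _ → u
  ; injective = λ { {zero} {zero} _ → refl }
  ; start = refl ; end = refl
  ; steps = λ ()
  }
walk⇒trail {n} {E} {u} {v} (e ◅ es) = extend (walk⇒trail es) e
  where
  -- Loop erasure: if u is already on the trail, restart from that occurrence.
  extend : ∀ {w} → Trail E w v → E u w → Trail E u v
  extend t e with any? (λ i → Trail.c t i ≟ᶠ u)
  ... | yes (i , refl) = dropTrail c injective end steps i where open Trail t
  ... | no fresh = record
    { c = c′ ; injective = c′-injective ; start = refl ; end = end ; steps = steps′ }
    where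
    open Trail t
    c′ : Fin (2 + length) → Fin n
    c′ zero    = u
    c′ (suc i) = c i
    c′-injective : Injective _≡_ _≡_ c′
    c′-injective {zero}  {zero}  _  = refl
    c′-injective {zero}  {suc j} eq = contradiction (j , sym eq) fresh
    c′-injective {suc i} {zero}  eq = contradiction (i , eq) fresh
    c′-injective {suc i} {suc j} eq = cong suc (injective eq)
    steps′ : ∀ i → E (c′ (inject₁ i)) (c′ (suc i))
    steps′ zero    = subst (E u) (sym start) e
    steps′ (suc i) = steps i

-- Only the orientation from `u` to `v` is excluded; a trail starting at `u` never returns to `u`,
-- so it cannot use the reverse step.
AvoidingEdge : (G : Graph n) (u v a b : Fin n) → Set
AvoidingEdge G u v a b = Adj G a b × ¬ (a ≡ u × b ≡ v)

-- After loop erasure, length 0 would make `uv` a loop, length 1 is the excluded step, and any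
-- longer trail closes to a cycle through `uv`.
bridge : ∀ (G : Graph n) → ¬ Cycle G → ∀ {u v} → Adj G u v → ¬ Star (AvoidingEdge G u v) u v
bridge G acyclic {u} {v} uv walk = go (walk⇒trail walk)
  where
  go : ¬ Trail (AvoidingEdge G u v) u v
  go record { length = zero ; start = refl ; end = refl } = Adj-irrefl G uv
  go record { length = suc zero ; start = refl ; end = refl ; steps = steps } =
    proj₂ (steps zero) (refl , refl)
  go record { length = suc (suc k) ; c = c ; injective = inj
            ; start = refl ; end = refl ; steps = steps } =
    acyclic record { c = c ; injective = inj ; steps = proj₁ ∘ steps ; closes = Adj-sym G uv }

leaving-step : ∀ {E : V → V → Set} {P : V → Set} → (∀ v → Dec (P v)) →
  ∀ {u v} → Star E u v → P u → ¬ P v → ∃[ x ] ∃[ y ] P x × ¬ P y × E x y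
leaving-step P? ε pu ¬pv = contradiction pu ¬pv
leaving-step P? {u} (_◅_ {j = w} e es) pu ¬pv with P? w
... | yes pw = leaving-step P? es pw ¬pv
... | no ¬pw = u , w , pu , ¬pw , e

path-hom : ∀ {k} {E : V → V → Set} → (∀ {x y} → E x y → E y x) →
  (c : Fin (suc k) → V) → (∀ i → E (c (inject₁ i)) (c (suc i))) →
  ∀ {u v} → Adj (path (suc k)) u v → E (c u) (c v)
path-hom {k = k} {E} E-sym c steps = λ { (inj₁ eq) → forward _ _ eq ; (inj₂ eq) → E-sym (forward _ _ eq) }
  where
  forward : ∀ u v → suc (toℕ u) ≡ toℕ v → E (c u) (c v)
  forward u (suc i) eq =
    subst (λ w → E (c w) (c (suc i)))
      (toℕ-injective (trans (toℕ-inject₁ i) (sym (ℕ.suc-injective eq)))) (steps i)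

path-connected : ∀ k → Connected (path (suc k))
path-connected k u v = reverse (Adj-sym (path (suc k))) (from-start u) ◅◅ from-start v
  where
  -- The sequence `c` is arbitrary so that the recursion can shift it to `c ∘ suc`.
  walk : ∀ {V : Set} {E : V → V → Set} {k} (c : Fin (suc k) → V) →
    (∀ i → E (c (inject₁ i)) (c (suc i))) → ∀ i → Star E (c zero) (c i)
  walk c steps zero = ε
  walk {k = suc k} c steps (suc i) = steps zero ◅ walk (c ∘ suc) (steps ∘ suc) i
  from-start : ∀ i → Star (Adj (path (suc k))) zero i
  from-start = walk id λ i → inj₁ (cong suc (toℕ-inject₁ i))

-- Colourings in which the bichromatic edges form a perfect matching

record Matching (E : V → V → Set) (c : V → Colour) : Set where
  field
    mate        : V → V
    mate-adj    : ∀ v → E v (mate v)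
    mate-colour : ∀ v → c (mate v) ≡ flip (c v)
    mate-unique : ∀ {v w} → E v w → c w ≡ flip (c v) → w ≡ mate v

  mate-of : ∀ {a v} → c v ≡ a → c (mate v) ≡ flip a
  mate-of cv = trans (mate-colour _) (cong flip cv)

  module _ (E-sym : ∀ {x y} → E x y → E y x) where

    -- Each vertex is an opposite-coloured neighbour of its own mate, and such a neighbour is
    -- unique.
    mate-involutive : ∀ v → mate (mate v) ≡ v
    mate-involutive v = sym (mate-unique (E-sym (mate-adj v))
      (sym (trans (cong flip (mate-colour v)) (flip-involutive (c v)))))

    mate-injective : Injective _≡_ _≡_ mate
    mate-injective {u} {v} eq =
      trans (sym (mate-involutive u)) (trans (cong mate eq) (mate-involutive v))

AmberNeighbours : (V → V → Set) → (V → Colour) → Set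
AmberNeighbours E c = ∀ {v} → c v ≡ amber → ∃[ w ] E v w × c w ≡ amber

module _ (i : V ↔ W) {E : V → V → Set} {F : W → W → Set} {c : V → Colour} {d : W → Colour}
  (edges : ∀ u v → E u v ⇔ F (Inverse.to i u) (Inverse.to i v))
  (colours : ∀ u → c u ≡ d (Inverse.to i u)) where
  open Inverse i using (to; from; strictlyInverseˡ; strictlyInverseʳ)

  -- Used both to pass from `Fin m ⊎ Fin p` to the vertex set `Fin (m + p)` of a join, and to pass
  -- from a member of the family to an isomorphic tree.
  matching-pullback : Matching F d → Matching E c
  matching-pullback M = record
    { mate        = mate′
    ; mate-adj    = λ v → Equivalence.from (edges v (mate′ v))
                      (subst (F (to v)) (sym (to-mate v)) (mate-adj (to v)))
    ; mate-colour = λ v → trans (colours _) (trans (cong d (to-mate v))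
                      (trans (mate-colour (to v)) (cong flip (sym (colours v)))))
    ; mate-unique = λ {v} {w} vw cw → trans (sym (strictlyInverseʳ w)) (cong from
                      (mate-unique (Equivalence.to (edges v w) vw)
                        (trans (sym (colours w)) (trans cw (cong flip (colours v))))))
    }
    where
    open Matching M
    mate′ : V → V
    mate′ v = from (mate (to v))
    to-mate : ∀ v → to (mate′ v) ≡ mate (to v)
    to-mate v = strictlyInverseˡ (mate (to v))

  amberNeighbours-pullback : AmberNeighbours F d → AmberNeighbours E c
  amberNeighbours-pullback nbr {v} cv =
    let (w , vw , dw) = nbr (trans (sym (colours v)) cv) in
    from w ,
    Equivalence.from (edges v (from w)) (subst (F (to v)) (sym (strictlyInverseˡ w)) vw) ,
    trans (colours (from w)) (trans (cong d (strictlyInverseˡ w)) dw)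

-- Joins, and the invariant preserved by both operations

module _ {p : ℕ} (G : Graph m) (H : Graph p) (x : Fin m) (y : Fin p) where

  JoinAdj-connected : Connected G → Connected H → ∀ a b → Star (JoinAdj G H x y) a b
  JoinAdj-connected cG cH = λ where
      (inj₁ u) (inj₁ v) → left (cG u v)
      (inj₁ u) (inj₂ v) → left (cG u x) ◅◅ (refl , refl) ◅ right (cH y v)
      (inj₂ u) (inj₁ v) → right (cH u y) ◅◅ (refl , refl) ◅ left (cG x v)
      (inj₂ u) (inj₂ v) → right (cH u v)
    where
    left : ∀ {u v} → Star (Adj G) u v → Star (JoinAdj G H x y) (inj₁ u) (inj₁ v)
    left = gmap inj₁ id
    right : ∀ {u v} → Star (Adj H) u v → Star (JoinAdj G H x y) (inj₂ u) (inj₂ v)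
    right = gmap inj₂ id

  join-connected : Connected G → Connected H → Connected (join G H x y)
  join-connected cG cH u v =
    subst₂ (Star (Adj (join G H x y))) (strictlyInverseʳ u) (strictlyInverseʳ v)
      (gmap from (λ {a} {b} →
          subst₂ (JoinAdj G H x y) (sym (strictlyInverseˡ a)) (sym (strictlyInverseˡ b)))
        (JoinAdj-connected cG cH (splitAt m u) (splitAt m v)))
    where open Inverse (+↔⊎ {m} {p})

  -- The joining edge is monochromatic, so it gives no vertex a new neighbour of the other colour
  -- and all mates persist.
  join-matching : ∀ {c d} → Matching (Adj G) c → Matching (Adj H) d → c x ≡ d y →
    Matching (JoinAdj G H x y) [ c , d ]′
  join-matching {c} {d} M M′ cx≡dy = record
    { mate        = λ { (inj₁ u) → inj₁ (A.mate u) ; (inj₂ u) → inj₂ (B.mate u) }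
    ; mate-adj    = λ { (inj₁ u) → A.mate-adj u ; (inj₂ u) → B.mate-adj u }
    ; mate-colour = λ { (inj₁ u) → A.mate-colour u ; (inj₂ u) → B.mate-colour u }
    ; mate-unique = λ
        { {inj₁ u} {inj₁ v} e eq → cong inj₁ (A.mate-unique e eq)
        ; {inj₁ u} {inj₂ v} (refl , refl) eq →
            contradiction (trans cx≡dy eq) (a≢flip[a] (c x))
        ; {inj₂ u} {inj₁ v} (refl , refl) eq →
            contradiction (trans (sym cx≡dy) eq) (a≢flip[a] (d y))
        ; {inj₂ u} {inj₂ v} e eq → cong inj₂ (B.mate-unique e eq)
        }
    }
    where
    module A = Matching M
    module B = Matching M′

-- For a concrete graph the conditions are decidable, so `checked` is found by evaluation.
matching-by : ∀ (T : ColouredGraph) (mate : Fin (order T) → Fin (order T)) →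
  True (all? λ v → Adj? (graph T) v (mate v) ×-dec (colour T (mate v) ≟ᶜ flip (colour T v)) ×-dec
    all? λ w → Adj? (graph T) v w →-dec ((colour T w ≟ᶜ flip (colour T v)) →-dec (w ≟ᶠ mate v))) →
  Matching (Adj (graph T)) (colour T)
matching-by T mate checked = record
  { mate        = mate
  ; mate-adj    = λ v → proj₁ (holds v)
  ; mate-colour = λ v → proj₁ (proj₂ (holds v))
  ; mate-unique = λ {v} {w} → proj₂ (proj₂ (holds v)) w
  }
  where holds = toWitness checked

record Balanced (T : ColouredGraph) : Set where
  field
    connected       : Connected (graph T)
    matching        : Matching (Adj (graph T)) (colour T)
    amberNeighbours : AmberNeighbours (Adj (graph T)) (colour T)

P₂-matching : Matching (Adj (graph P₂)) (colour P₂)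
P₂-matching = matching-by P₂ (lookup (suc zero ∷ zero ∷ [])) _

P₄-balanced : Balanced P₄
P₄-balanced = record
  { connected       = path-connected 3
  ; matching        = matching-by P₄
      (lookup (suc zero ∷ zero ∷ suc (suc (suc zero)) ∷ suc (suc zero) ∷ [])) _
  ; amberNeighbours = λ
      { {suc zero}             refl → suc (suc zero) , inj₁ refl , refl
      ; {suc (suc zero)}       refl → suc zero , inj₂ refl , refl
      ; {suc (suc (suc zero))} ()
      }
  }

-- The amber-neighbour condition on the added part refers to the whole join: the amber vertex of
-- `P₂` obtains its amber neighbour only through the joining edge.
attach-balanced : ∀ {T P x y} → Balanced T → Connected (graph P) →
  Matching (Adj (graph P)) (colour P) → colour T x ≡ colour P y →
  (∀ {v} → colour P v ≡ amber →
    ∃[ w ] JoinAdj (graph T) (graph P) x y (inj₂ v) w × [ colour T , colour P ]′ w ≡ amber) →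
  Balanced (attach T P x y)
attach-balanced {T} {P} {x} {y} B connP M same nbr = record
  { connected       = join-connected (graph T) (graph P) x y B.connected connP
  ; matching        = matching-pullback +↔⊎ (λ _ _ → mk⇔ id id) (λ _ → refl)
                        (join-matching (graph T) (graph P) x y B.matching M same)
  ; amberNeighbours = amberNeighbours-pullback +↔⊎ {F = JoinAdj (graph T) (graph P) x y}
      (λ _ _ → mk⇔ id id) (λ _ → refl) λ
      { {inj₁ u} cu → let (w , uw , cw) = B.amberNeighbours cu in inj₁ w , uw , cw
      ; {inj₂ u} cu → nbr cu
      }
  }
  where module B = Balanced B

⟶-balanced : ∀ {T U} → T ⟶ U → Balanced T → Balanced U
⟶-balanced (𝒪₁ x zero cx refl) B =
  attach-balanced B (path-connected 1) P₂-matching cx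
    λ { {zero} refl → inj₁ x , (refl , refl) , cx ; {suc zero} () }
⟶-balanced (𝒪₁ x (suc zero) cx ()) B
⟶-balanced (𝒪₂ x y cx cy) B =
  attach-balanced B connected matching (trans cx (sym cy)) λ cv →
    let (w , vw , cw) = amberNeighbours cv in inj₂ w , vw , cw
  where open Balanced P₄-balanced

⟶*-balanced : ∀ {T U} → Star _⟶_ T U → Balanced T → Balanced U
⟶*-balanced ε        B = B
⟶*-balanced (s ◅ ss) B = ⟶*-balanced ss (⟶-balanced s B)

-- Growing a member of the family inside a given tree

-- Adjacency is only preserved here; that it is also reflected follows from acyclicity of the target
-- in `↪-induced`.
record _↪_ (U T : ColouredGraph) : Set where
  field
    f         : Fin (order U) → Fin (order T)
    injective : Injective _≡_ _≡_ f
    hom       : ∀ {u v} → Adj (graph U) u v → Adj (graph T) (f u) (f v)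
    colours   : ∀ u → colour T (f u) ≡ colour U u

open _↪_ using (f)

-- An edge between images of non-adjacent vertices would close a cycle with the
-- image of a walk joining them.
↪-induced : ∀ {U T} (e : U ↪ T) → Connected (graph U) → ¬ Cycle (graph T) →
  ∀ {u v} → Adj (graph T) (f e u) (f e v) → Adj (graph U) u v
↪-induced {U} {T} e conn acyclic {u} {v} fufv with Adj? (graph U) u v
... | yes uv = uv
... | no ¬uv = contradiction
  (gmap (f e) (λ ij → hom ij ,
      λ (p , q) → ¬uv (subst₂ (Adj (graph U)) (injective p) (injective q) ij))
    (conn u v))
  (bridge (graph T) acyclic fufv)
  where open _↪_ e using (injective; hom)

surjective⇒≅ : ∀ {U T} (e : U ↪ T) → Connected (graph U) → ¬ Cycle (graph T) →
  (∀ v → ∃[ u ] f e u ≡ v) → U ≅ T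
surjective⇒≅ e conn acyclic surj = record
  { vertices = mk↔ₛ′ (f e) (proj₁ ∘ surj) (proj₂ ∘ surj) λ u → injective (proj₂ (surj (f e u)))
  ; adjacent = λ u v → mk⇔ hom (↪-induced e conn acyclic)
  ; colours  = colours
  }
  where open _↪_ e using (injective; hom; colours)

attach-↪ : ∀ {U P T x y} (g : U ↪ T) (h : P ↪ T) → (∀ u p → f g u ≢ f h p) →
  Adj (graph T) (f g x) (f h y) → attach U P x y ↪ T
attach-↪ {U} {P} {T} {x} {y} g h disjoint gxhy = record
  { f         = sum ∘ splitAt (order U)
  ; injective = λ {i} {j} eq → trans (sym (strictlyInverseʳ i))
      (trans (cong from (sum-injective (splitAt (order U) i) (splitAt (order U) j) eq)) (strictlyInverseʳ j))
  ; hom       = λ {i} {j} → sum-hom (splitAt (order U) i) (splitAt (order U) j)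
  ; colours   = λ i → sum-colours (splitAt (order U) i)
  }
  where
  module g = _↪_ g
  module h = _↪_ h
  open Inverse (+↔⊎ {order U} {order P}) using (from; strictlyInverseʳ)
  sum : Fin (order U) ⊎ Fin (order P) → Fin (order T)
  sum = [ f g , f h ]′
  sum-injective : ∀ a b → sum a ≡ sum b → a ≡ b
  sum-injective (inj₁ u) (inj₁ v) eq = cong inj₁ (g.injective eq)
  sum-injective (inj₁ u) (inj₂ v) eq = contradiction eq (disjoint u v)
  sum-injective (inj₂ u) (inj₁ v) eq = contradiction (sym eq) (disjoint v u)
  sum-injective (inj₂ u) (inj₂ v) eq = cong inj₂ (h.injective eq)
  sum-hom : ∀ a b → JoinAdj (graph U) (graph P) x y a b → Adj (graph T) (sum a) (sum b)
  sum-hom (inj₁ u) (inj₁ v) e = g.hom e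
  sum-hom (inj₁ u) (inj₂ v) (refl , refl) = gxhy
  sum-hom (inj₂ u) (inj₁ v) (refl , refl) = Adj-sym (graph T) gxhy
  sum-hom (inj₂ u) (inj₂ v) e = h.hom e
  sum-colours : ∀ a → colour T (sum a) ≡ [ colour U , colour P ]′ a
  sum-colours (inj₁ u) = g.colours u
  sum-colours (inj₂ u) = h.colours u

module Growth (T : ColouredGraph)
  (acyclic : ¬ Cycle (graph T)) (M : Matching (Adj (graph T)) (colour T))
  (amberNeighbours : AmberNeighbours (Adj (graph T)) (colour T)) where

  private
    G = graph T
    c = colour T
    Vertex = Fin (order T)

  open Matching M

  mate-mate : ∀ v → mate (mate v) ≡ v
  mate-mate = mate-involutive (Adj-sym G)

  adj⇒≢ : ∀ {u v} → Adj G u v → u ≢ v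
  adj⇒≢ uv refl = Adj-irrefl G uv

  colour-separates : ∀ {u v} → c u ≡ amber → c v ≡ blue → u ≢ v
  colour-separates cu cv refl with () ← trans (sym cu) cv

  P₂-embedding : ∀ {a} → c a ≡ amber → P₂ ↪ T
  P₂-embedding {a} ca = record
    { f         = lookup (a ∷ mate a ∷ [])
    ; injective = lookup-injective ((adj⇒≢ (mate-adj a) ∷ []) ∷ [] ∷ []) _ _
    ; hom       = path-hom {E = Adj G} (Adj-sym G) (lookup (a ∷ mate a ∷ [])) λ { zero → mate-adj a }
    ; colours   = λ { zero → ca ; (suc zero) → mate-of ca }
    }

  -- Of the six pairs of vertices, three are distinct as edges, two by colour, and the two ends
  -- because `mate` is injective.
  P₄-embedding : ∀ {a z} → c a ≡ amber → c z ≡ amber → Adj G a z → P₄ ↪ T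
  P₄-embedding {a} {z} ca cz az = record
    { f         = lookup vs
    ; injective = lookup-injective
        ( (adj⇒≢ a′a ∷ (colour-separates cz (mate-of ca) ∘ sym) ∷ (adj⇒≢ az ∘ mate-injective (Adj-sym G)) ∷ [])
        ∷ (adj⇒≢ az ∷ colour-separates ca (mate-of cz) ∷ [])
        ∷ (adj⇒≢ (mate-adj z) ∷ [])
        ∷ [] ∷ []) _ _
    ; hom       = path-hom {E = Adj G} (Adj-sym G) (lookup vs)
        λ { zero → a′a ; (suc zero) → az ; (suc (suc zero)) → mate-adj z }
    ; colours   = λ where
        zero → mate-of ca
        (suc zero) → ca
        (suc (suc zero)) → cz
        (suc (suc (suc zero))) → mate-of cz
    }
    where
    vs = mate a ∷ a ∷ z ∷ mate z ∷ []
    a′a : Adj G (mate a) a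
    a′a = Adj-sym G (mate-adj a)

  module _ {U : ColouredGraph} (B : Balanced U) (e : U ↪ T) where
    private
      module U = Balanced B
      module UM = Matching U.matching
      module e = _↪_ e

    Outside : Vertex → Set
    Outside v = ∀ u → f e u ≢ v

    -- Edges and colours are preserved, so the image of a mate meets the condition that determines
    -- the mate in `T`.
    f-mate : ∀ u → f e (UM.mate u) ≡ mate (f e u)
    f-mate u = mate-unique (e.hom (UM.mate-adj u))
      (trans (e.colours _) (trans (UM.mate-colour u) (cong flip (sym (e.colours u)))))

    -- The image is closed under the involution `mate`, hence so is its complement.
    mate-outside : ∀ {v} → Outside v → Outside (mate v)
    mate-outside {v} out u eq =
      out (UM.mate u) (trans (f-mate u) (trans (cong mate eq) (mate-mate v)))

    -- A neighbour of the other colour would be the mate of `f e x`, which lies in the image.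
    leaving-edge-monochromatic : ∀ {x y} → Outside y → Adj G (f e x) y → c y ≡ colour U x
    leaving-edge-monochromatic {x} {y} out xy with a≡b⊎a≡flip[b] (c y) (c (f e x))
    ... | inj₁ same = trans same (e.colours x)
    ... | inj₂ opp  = contradiction (trans (f-mate x) (sym (mate-unique xy opp))) (out (UM.mate x))

    Extension : Set₁
    Extension = ∃[ U′ ] (U ⟶ U′) × (U′ ↪ T) × order U < order U′

    extend-amber : ∀ {x y} → Outside y → Adj G (f e x) y → c y ≡ amber → Extension
    extend-amber {x} {y} out xy cy =
      attach U P₂ x zero ,
      𝒪₁ x zero (trans (sym (leaving-edge-monochromatic out xy)) cy) refl ,
      attach-↪ e (P₂-embedding cy)
        (λ { u zero → out u ; u (suc zero) → mate-outside out u }) xy ,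
      m<m+n (order U) (s≤s z≤n)

    extend-blue : ∀ {x y} → Outside y → Adj G (f e x) y → c y ≡ blue → Extension
    extend-blue {x} {y} out xy cy with amberNeighbours (mate-of cy)
    ... | z , yz , cz =
      attach U P₄ x zero ,
      𝒪₂ x zero (trans (sym (leaving-edge-monochromatic out xy)) cy) refl ,
      attach-↪ e (P₄-embedding (mate-of cy) cz yz)
        (λ { u zero → out-y u
           ; u (suc zero) → mate-outside out u
           ; u (suc (suc zero)) → out-z u
           ; u (suc (suc (suc zero))) → mate-outside out-z u })
        -- The embedded path starts at the mate of `mate y`, which equals `y` only propositionally.
        (subst (Adj G (f e x)) (sym (mate-mate y)) xy) ,
      m<m+n (order U) (s≤s z≤n)
      where
      out-y : Outside (mate (mate y))
      out-y = subst Outside (sym (mate-mate y)) out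
      -- Otherwise z is reachable from x inside U, and xy lies on a cycle.
      out-z : Outside z
      out-z w refl = bridge G acyclic xy
        ( gmap (f e) (λ {_} {j} ij → e.hom ij , out j ∘ proj₂) (U.connected x w)
        ◅◅ (Adj-sym G yz , λ (_ , eq) → adj⇒≢ (mate-adj y) (sym eq))
        ◅ (Adj-sym G (mate-adj y) , λ (eq , _) → mate-outside out x (sym eq))
        ◅ ε)

    extend : ∀ {x y} → Outside y → Adj G (f e x) y → Extension
    extend {y = y} out xy with c y in cy
    ... | amber = extend-amber out xy cy
    ... | blue  = extend-blue out xy cy

  -- While the image misses a vertex, a walk from the image of `u₀` to it has a step leaving the
  -- image, along which `U` is extended. Each extension raises `order U`, so the bound survives one
  -- unit less of fuel; with no fuel left, `U` would be too large to embed injectively.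
  grow : Connected G → ∀ fuel {U} → order T < order U + fuel →
    Star _⟶_ P₄ U → Balanced U → Fin (order U) → U ↪ T → 𝒯 T
  grow conn fuel {U} bound steps B u₀ e
    with all? (λ v → any? λ u → f e u ≟ᶠ v)
  ... | yes surj = U , steps , surjective⇒≅ e (Balanced.connected B) acyclic surj
  grow conn zero {U} bound steps B u₀ e | no ¬surj =
    contradiction (subst (order T <_) (+-identityʳ (order U)) bound)
      (≤⇒≯ (injective⇒≤ (_↪_.injective e)))
  grow conn (suc fuel) {U} bound steps B u₀ e | no ¬surj
    with ¬∀⟶∃¬ _ _ (λ v → any? λ u → f e u ≟ᶠ v) ¬surj
  ... | v , v∉
    with leaving-step (λ v → any? λ u → f e u ≟ᶠ v) (conn (f e u₀) v) (u₀ , refl) v∉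
  ... | _ , y , (x , refl) , y∉ , xy with extend B e (λ u eq → y∉ (u , eq)) xy
  ... | U′ , step , e′ , larger =
    grow conn fuel
      (≤-trans bound (≤-trans (≤-reflexive (+-suc (order U) fuel)) (+-monoˡ-≤ fuel larger)))
      (steps ◅◅ return step) (⟶-balanced step B) (inject≤ u₀ (<⇒≤ larger)) e′

  member : Connected G → Vertex → 𝒯 T
  member conn v = start (amber-vertex v)
    where
    amber-vertex : Vertex → ∃[ a ] c a ≡ amber
    amber-vertex v with c v in cv
    ... | amber = v , cv
    ... | blue  = mate v , mate-of cv
    start : ∃[ a ] c a ≡ amber → 𝒯 T
    start (a , ca) with amberNeighbours ca
    ... | z , az , cz =
      -- `P₄` has order 4, so the bound unfolds to `suc (order T) ≤ 3 + suc (order T)`.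
      grow conn (order T) (m≤n+m _ 3) ε P₄-balanced zero (P₄-embedding ca cz az)

-- Cardinalities of subsets

-- A relation serves in place of a function, since images are chosen only for elements of `p`. The
-- partner `y₀` of the first element is deleted from `q`; no later element can be related to it.
∣p∣≤∣q∣-by-injection : ∀ {p : Subset m} {q : Subset n} (R : Fin m → Fin n → Set) →
  (∀ {x} → x ∈ p → ∃[ y ] y ∈ q × R x y) →
  (∀ {x x′ y} → R x y → R x′ y → x ≡ x′) → ∣ p ∣ ≤ ∣ q ∣
∣p∣≤∣q∣-by-injection {p = []} R total inj = z≤n
∣p∣≤∣q∣-by-injection {p = outside ∷ p} R total inj =
  ∣p∣≤∣q∣-by-injection (R ∘ suc) (total ∘ there) λ r r′ → suc-injective (inj r r′)
∣p∣≤∣q∣-by-injection {p = inside ∷ p} {q} R total inj with total here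
... | y₀ , y₀∈q , r₀ = ≤-trans
  (s≤s (∣p∣≤∣q∣-by-injection {p = p} {q - y₀} (R ∘ suc)
    (λ x∈p → let (y , y∈q , r) = total (there x∈p) in
      y , x∈p∧x≢y⇒x∈p-y y∈q (λ { refl → contradiction (inj r₀ r) λ () }) , r)
    λ r r′ → suc-injective (inj r r′)))
  (x∈p⇒∣p-x∣<∣p∣ y₀∈q)

x∈p⇒1≤∣p∣ : ∀ {p : Subset n} {x} → x ∈ p → 1 ≤ ∣ p ∣
x∈p⇒1≤∣p∣ x∈p = ≤-trans (s≤s z≤n) (x∈p⇒∣p-x∣<∣p∣ x∈p)

x,y∈p⇒2≤∣p∣ : ∀ {p : Subset n} {x y} → x ∈ p → y ∈ p → y ≢ x → 2 ≤ ∣ p ∣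
x,y∈p⇒2≤∣p∣ x∈p y∈p y≢x =
  ≤-trans (s≤s (x∈p⇒1≤∣p∣ (x∈p∧x≢y⇒x∈p-y y∈p y≢x))) (x∈p⇒∣p-x∣<∣p∣ x∈p)

⁅⁆-injective : ∀ {x y : Fin n} → ⁅ x ⁆ ≡ ⁅ y ⁆ → x ≡ y
⁅⁆-injective {x = x} {y} eq = x∈⁅y⁆⇒x≡y y (subst (x ∈_) eq (x∈⁅x⁆ x))

module _ {P : Fin n → Set} (P? : ∀ x → Dec (P x)) where

  ∈-tabulate⁺ : ∀ {x} → P x → x ∈ tabulate (does ∘ P?)
  ∈-tabulate⁺ {x} px =
    lookup⇒[]= x _ (trans (lookup∘tabulate (does ∘ P?) x) (dec-true (P? x) px))

  ∈-tabulate⁻ : ∀ {x} → x ∈ tabulate (does ∘ P?) → P x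
  ∈-tabulate⁻ {x} x∈ with P? x | trans (sym (lookup∘tabulate (does ∘ P?) x)) ([]=⇒lookup x∈)
  ... | yes px | _ = px
  ... | no _   | ()

n∸k≡k⇒2*k≡n : ∀ {k n} → n ∸ k ≡ k → k ≤ n → 2 * k ≡ n
n∸k≡k⇒2*k≡n {k} {n} eq k≤n = begin
  k + (k + 0) ≡⟨ cong (k +_) (+-identityʳ k) ⟩
  k + k       ≡⟨ cong (k +_) (sym eq) ⟩
  k + (n ∸ k) ≡⟨ m+[n∸m]≡n k≤n ⟩
  n           ∎
  where open ≡-Reasoning

-- ESD-sets: guards and the counting bound

module _ (G : Graph n) where

  ∈N⁺ : ∀ {u v} → Adj G v u → u ∈ N G v
  ∈N⁺ {v = v} = ∈-tabulate⁺ (Adj? G v)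

  ∈N⁻ : ∀ {u v} → u ∈ N G v → Adj G v u
  ∈N⁻ {v = v} = ∈-tabulate⁻ (Adj? G v)

  module _ (S : Subset n) where

    Private : Fin n → Fin n → Set
    Private u v = N G v ∩ ∁ S ≡ ⁅ u ⁆

    private-adj : ∀ {u v} → Private u v → Adj G v u
    private-adj {u} {v} eq = ∈N⁻ (proj₁ (x∈p∩q⁻ (N G v) (∁ S) (subst (u ∈_) (sym eq) (x∈⁅x⁆ u))))

    private-∉ : ∀ {u v} → Private u v → u ∉ S
    private-∉ {u} {v} eq =
      x∈∁p⇒x∉p (proj₂ (x∈p∩q⁻ (N G v) (∁ S) (subst (u ∈_) (sym eq) (x∈⁅x⁆ u))))

    private-unique : ∀ {u v w} → Private u v → Adj G v w → w ∉ S → w ≡ u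
    private-unique {u} {v} {w} eq vw w∉S =
      x∈⁅y⁆⇒x≡y u (subst (w ∈_) eq (x∈p∩q⁺ (∈N⁺ vw , x∉p⇒x∈∁p w∉S)))

    private-functional : ∀ {u u′ v} → Private u v → Private u′ v → u ≡ u′
    private-functional eq eq′ = ⁅⁆-injective (trans (sym eq) eq′)

    -- A guard determines the vertex it guards, so choosing guards is injective.
    ESD⇒∣∁S∣≤∣S∣ : IsESD G S → ∣ ∁ S ∣ ≤ ∣ S ∣
    ESD⇒∣∁S∣≤∣S∣ esd =
      ∣p∣≤∣q∣-by-injection Private (λ {u} u∈ → proj₁ (esd u u∈)) private-functional

    ESD⇒n≤2∣S∣ : IsESD G S → n ≤ 2 * ∣ S ∣
    ESD⇒n≤2∣S∣ esd = begin
      n                   ≡⟨ m+[n∸m]≡n (∣p∣≤n S) ⟨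
      ∣ S ∣ + (n ∸ ∣ S ∣) ≡⟨ cong (∣ S ∣ +_) (∣∁p∣≡n∸∣p∣ S) ⟨
      ∣ S ∣ + ∣ ∁ S ∣     ≤⟨ +-monoʳ-≤ ∣ S ∣ (ESD⇒∣∁S∣≤∣S∣ esd) ⟩
      ∣ S ∣ + ∣ S ∣       ≡⟨ cong (∣ S ∣ +_) (+-identityʳ ∣ S ∣) ⟨
      2 * ∣ S ∣           ∎
      where open ≤-Reasoning

    colouring : Fin n → Colour
    colouring u = if does (u ∈? S) then blue else amber

    colouring-blue : ∀ {u} → u ∈ S → colouring u ≡ blue
    colouring-blue {u} u∈S with u ∈? S
    ... | yes _  = refl
    ... | no u∉S = contradiction u∈S u∉S

    colouring-amber : ∀ {u} → u ∉ S → colouring u ≡ amber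
    colouring-amber {u} u∉S with u ∈? S
    ... | yes u∈S = contradiction u∈S u∉S
    ... | no _    = refl

    blue⇒∈ : ∀ {u} → colouring u ≡ blue → u ∈ S
    blue⇒∈ {u} eq with u ∈? S
    blue⇒∈ eq | yes u∈S = u∈S
    blue⇒∈ () | no _

    amber⇒∉ : ∀ {u} → colouring u ≡ amber → u ∉ S
    amber⇒∉ {u} eq with u ∈? S
    amber⇒∉ () | yes _
    amber⇒∉ eq | no u∉S = u∉S

    -- Equality in the bound: the colouring given by an ESD-set of half size

    module HalfESD (esd : IsESD G S) (half : 2 * ∣ S ∣ ≡ n) where

      ∣∁S∣≡∣S∣ : ∣ ∁ S ∣ ≡ ∣ S ∣
      ∣∁S∣≡∣S∣ = begin
        ∣ ∁ S ∣                     ≡⟨ ∣∁p∣≡n∸∣p∣ S ⟩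
        n ∸ ∣ S ∣                   ≡⟨ cong (_∸ ∣ S ∣) half ⟨
        ∣ S ∣ + (∣ S ∣ + 0) ∸ ∣ S ∣ ≡⟨ m+n∸m≡n ∣ S ∣ _ ⟩
        ∣ S ∣ + 0                   ≡⟨ +-identityʳ ∣ S ∣ ⟩
        ∣ S ∣                       ∎
        where open ≡-Reasoning

      guard : ∀ {u} → u ∉ S → ∃[ v ] v ∈ S × Private u v
      guard {u} u∉S = proj₁ (esd u (x∉p⇒x∈∁p u∉S))

      -- Otherwise the vertices outside `S` would inject into `S - v`, which is smaller than `S` and
      -- hence than `∁ S`.
      no-spare-guard : ∀ {v} → v ∈ S → ¬ (∀ u → u ∉ S → ∃[ w ] w ∈ S × w ≢ v × Private u w)
      no-spare-guard {v} v∈S guards = <-irrefl ∣∁S∣≡∣S∣ (≤-<-trans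
        (∣p∣≤∣q∣-by-injection {q = S - v} Private
          (λ {u} u∈ → let (w , w∈S , w≢v , pw) = guards u (x∈∁p⇒x∉p u∈) in
            w , x∈p∧x≢y⇒x∈p-y w∈S w≢v , pw)
          private-functional)
        (x∈p⇒∣p-x∣<∣p∣ v∈S))

      guards-someone : ∀ {v} → v ∈ S → ∃[ u ] Private u v
      guards-someone {v} v∈S with any? (λ u → ≡-dec _≟ᵇ_ (N G v ∩ ∁ S) ⁅ u ⁆)
      ... | yes found = found
      ... | no idle = contradiction
        (λ u u∉S → let (w , w∈S , pw) = guard u∉S in w , w∈S , (λ { refl → idle (_ , pw) }) , pw)
        (no-spare-guard v∈S)

      -- If `w` differed from `v`, it could replace `v` as guard of `u`; since `v` guards nothing
      -- else, `v` would be spare.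
      guard-unique : ∀ {u v w} → v ∈ S → w ∈ S → Private u v → Private u w → w ≡ v
      guard-unique {u} {v} {w} v∈S w∈S pv pw with w ≟ᶠ v
      ... | yes w≡v = w≡v
      ... | no w≢v = contradiction guards (no-spare-guard v∈S)
        where
        guards : ∀ u′ → u′ ∉ S → ∃[ w′ ] w′ ∈ S × w′ ≢ v × Private u′ w′
        guards u′ u′∉S with guard u′∉S
        ... | v′ , v′∈S , pv′ with v′ ≟ᶠ v
        ...   | no v′≢v = v′ , v′∈S , v′≢v , pv′
        ...   | yes refl = w , w∈S , w≢v , subst (λ x → Private x w) (private-functional pv pv′) pw

      -- The partner of a blue vertex is the vertex it guards, and that of an amber vertex is its
      -- guard. A blue neighbour of an amber `v` guards some vertex, which must be `v`, so it is the
      -- unique guard of `v`.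
      opposite : ∀ v → ∃[ w ] Adj G v w × colouring w ≡ flip (colouring v) ×
        (∀ {w′} → Adj G v w′ → colouring w′ ≡ flip (colouring v) → w′ ≡ w)
      opposite v with colouring v in cv
      ... | blue  = let (u , pu) = guards-someone (blue⇒∈ cv) in
        u , private-adj pu , colouring-amber (private-∉ pu) ,
        λ vw cw → private-unique pu vw (amber⇒∉ cw)
      ... | amber = let (w , w∈S , pw) = guard (amber⇒∉ cv) in
        w , Adj-sym G (private-adj pw) , colouring-blue w∈S ,
        λ {w′} vw′ cw′ → let (u , pu) = guards-someone (blue⇒∈ cw′) in
          guard-unique w∈S (blue⇒∈ cw′) pw
            (subst (λ x → Private x w′)
              (sym (private-unique pu (Adj-sym G vw′) (amber⇒∉ cv))) pu)

      matching : Matching (Adj G) colouring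
      matching = record
        { mate        = λ v → proj₁ (opposite v)
        ; mate-adj    = λ v → proj₁ (proj₂ (opposite v))
        ; mate-colour = λ v → proj₁ (proj₂ (proj₂ (opposite v)))
        ; mate-unique = λ {v} → proj₂ (proj₂ (proj₂ (opposite v)))
        }

      -- Without an amber neighbour, the only neighbour of `v` would be its mate, against degree at
      -- least 2.
      amberNeighbours : AmberNeighbours (Adj G) colouring
      amberNeighbours {v} cv
        with any? (λ w → Adj? G v w ×-dec (colouring w ≟ᶜ amber))
      ... | yes found = found
      ... | no none = contradiction (proj₂ (esd v (x∉p⇒x∈∁p (amber⇒∉ cv)))) (<⇒≱ (s≤s deg≤1))
        where
        open Matching matching
        N⊆ : ∀ {w} → w ∈ N G v → w ∈ ⁅ mate v ⁆
        N⊆ {w} w∈ with a≡b⊎a≡flip[b] (colouring w) (colouring v)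
        ... | inj₁ same = contradiction (w , ∈N⁻ w∈ , trans same cv) none
        ... | inj₂ opp  = subst (_∈ ⁅ mate v ⁆) (sym (mate-unique (∈N⁻ w∈) opp)) (x∈⁅x⁆ (mate v))
        deg≤1 : deg G v ≤ 1
        deg≤1 = subst (deg G v ≤_) (∣⁅x⁆∣≡1 (mate v)) (p⊆q⇒∣p∣≤∣q∣ N⊆)

  -- From a colouring to a minimum ESD-set

  module Colouring (c : Fin n → Colour) (M : Matching (Adj G) c)
    (amberNeighbours : AmberNeighbours (Adj G) c) where
    open Matching M

    blues : Subset n
    blues = tabulate λ u → does (c u ≟ᶜ blue)

    ∈blues⁺ : ∀ {u} → c u ≡ blue → u ∈ blues
    ∈blues⁺ = ∈-tabulate⁺ (λ u → c u ≟ᶜ blue)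

    ∈blues⁻ : ∀ {u} → u ∈ blues → c u ≡ blue
    ∈blues⁻ = ∈-tabulate⁻ (λ u → c u ≟ᶜ blue)

    ∈∁blues⁺ : ∀ {u} → c u ≡ amber → u ∈ ∁ blues
    ∈∁blues⁺ cu = x∉p⇒x∈∁p λ u∈ → contradiction (trans (sym cu) (∈blues⁻ u∈)) λ ()

    ∈∁blues⁻ : ∀ {u} → u ∈ ∁ blues → c u ≡ amber
    ∈∁blues⁻ {u} u∈ with c u in cu
    ... | amber = refl
    ... | blue  = contradiction (∈blues⁺ cu) (x∈∁p⇒x∉p u∈)

    -- An amber `u` is guarded by its mate, whose only amber neighbour is `u`. The mate and an amber
    -- neighbour of `u` differ in colour, which gives degree at least 2.
    blues-ESD : IsESD G blues
    blues-ESD u u∈ =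
      (mate u , ∈blues⁺ (mate-of cu) , ⊆-antisym
        (λ {w} w∈ → let (w∈N , w∈∁) = x∈p∩q⁻ (N G (mate u)) (∁ blues) w∈ in
          subst (_∈ ⁅ u ⁆) (sym (trans
            (mate-unique (∈N⁻ w∈N) (trans (∈∁blues⁻ w∈∁) (sym (cong flip (mate-of cu)))))
            (mate-involutive (Adj-sym G) u)))
            (x∈⁅x⁆ u))
        (λ w∈ → subst (_∈ N G (mate u) ∩ ∁ blues) (sym (x∈⁅y⁆⇒x≡y u w∈))
          (x∈p∩q⁺ (∈N⁺ (Adj-sym G (mate-adj u)) , u∈)))) ,
      (let (w , uw , cw) = amberNeighbours cu in
        x,y∈p⇒2≤∣p∣ (∈N⁺ (mate-adj u)) (∈N⁺ uw)
          λ w≡ → contradiction (trans (sym cw) (trans (cong c w≡) (mate-of cu))) λ ())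
      where cu = ∈∁blues⁻ u∈

    -- Guards bound the amber class by the blue one; `mate` injects the blue class into the amber
    -- one.
    2∣blues∣≡n : 2 * ∣ blues ∣ ≡ n
    2∣blues∣≡n = n∸k≡k⇒2*k≡n (trans (sym (∣∁p∣≡n∸∣p∣ blues)) (≤-antisym
        (ESD⇒∣∁S∣≤∣S∣ blues blues-ESD)
        (∣p∣≤∣q∣-by-injection (λ u v → mate u ≡ v)
          (λ {u} u∈ → mate u , ∈∁blues⁺ (mate-of (∈blues⁻ u∈)) , refl)
          (λ eq eq′ → mate-injective (Adj-sym G) (trans eq (sym eq′))))))
      (∣p∣≤n blues)

    2γesp≡n : 2 * γesp G ≡ n
    2γesp≡n with γesp-minimum G
    ... | _ , (S , esd , refl) , least = ≤-antisym
      (subst (2 * ∣ S ∣ ≤_) 2∣blues∣≡n (*-monoʳ-≤ 2 (least _ (blues , blues-ESD , refl))))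
      (ESD⇒n≤2∣S∣ S esd)

-- The equivalence

theorem4p3 : ∀ (n : ℕ) (T : Graph n) → n ≥ 2 → IsTree T →
    (2 * γesp T ≡ n ⇔ (∃[ c ] 𝒯 (coloured T c)))
theorem4p3 n T n≥2 (connected , acyclic) = mk⇔ forward backward
  where
  forward : 2 * γesp T ≡ n → ∃[ c ] 𝒯 (coloured T c)
  forward eq with γesp-minimum T
  ... | _ , (S , esd , refl) , _ =
    colouring T S ,
    Growth.member (coloured T (colouring T S)) acyclic matching amberNeighbours
      -- `n≥2` unfolds to `1 < n`, so this is the vertex with index 1; it or its mate is amber.
      connected (fromℕ< n≥2)
    where open HalfESD T S esd eq
  backward : ∃[ c ] 𝒯 (coloured T c) → 2 * γesp T ≡ n
  backward (c , U , steps , U≅T) =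
    Colouring.2γesp≡n T c
      (matching-pullback T↔U edges colours matching)
      (amberNeighbours-pullback T↔U {F = Adj (graph U)} edges colours amberNeighbours)
    where
    open Balanced (⟶*-balanced steps P₄-balanced) using (matching; amberNeighbours)
    open _≅_ U≅T using (vertices; adjacent) renaming (colours to ≅-colours)
    open Inverse vertices using (to; from; strictlyInverseˡ)
    T↔U : Fin n ↔ Fin (order U)
    T↔U = ↔-sym vertices
    edges : ∀ u v → Adj T u v ⇔ Adj (graph U) (from u) (from v)
    edges u v = mk⇔
      (λ uv → Equivalence.from (adjacent (from u) (from v))
        (subst₂ (Adj T) (sym (strictlyInverseˡ u)) (sym (strictlyInverseˡ v)) uv))
      (λ uv → subst₂ (Adj T) (strictlyInverseˡ u) (strictlyInverseˡ v)
        (Equivalence.to (adjacent (from u) (from v)) uv))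
    colours : ∀ u → c u ≡ colour U (from u)
    colours u = trans (cong c (sym (strictlyInverseˡ u))) (≅-colours (from u))
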